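{- Let $G$ be a finite group with an abelian subgroup $H$ of index two, let $S\subseteq G\setminus\{1_G\}$ be inverse-closed, and let $X=\mathrm{Cay}(G,S)$. If $gSg^{ -1}=S$ for some $g\in G\setminus H$, then $A=\langle R(H),L_g\rangle$ is an abelian regular subgroup of $\mathrm{Aut}(X)$ of order $|G|$; in particular, $X$ is a Cayley graph of an abelian group. If moreover $g^2=1_G$, then $A\cong H\times C_2$.
   Context: For a group $G$ and an inverse-closed subset $S\subseteq G\setminus\{1_G\}$, $\mathrm{Cay}(G,S)$ is the graph with vertex set $G$ in which $g\sim h$ if and only if $hg^{ -1}\in S$. A graph $X$ is a Cayley graph of a group $K$ if $X\cong\mathrm{Cay}(K,S')$ for some inverse-closed $S'\subseteq K\setminus\{1_K\}$. For $a\in G$, $R_a$ and $L_a$ denote the permutations $x\mapsto xa$ and $x\mapsto ax$ of $G$; for a subgroup $H\le G$, $R(H)=\{R_h:h\in H\}$. A permutation group is regular if it is transitive and all point stabilizers are trivial. $C_2$ is the cyclic group of order two. -}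

module Defs where

open import Algebra.Bundles using (Group)
open import Algebra.Definitions using (Commutative)
import Algebra.Construct.DirectProduct as DirectProduct
import Algebra.Morphism.Structures as Morphism
import Algebra.Properties.Group as GroupProperties
open import Data.Fin.Base using (Fin)
open import Data.Nat.Base using (ℕ)
import Data.Parity.Properties as Parity
open import Data.Product.Base using (Σ; ∃; _×_; _,_; proj₁; proj₂)
open import Function.Base using (_∘_; _on_)
open import Function.Bundles using (Inverse; _⇔_; mk⇔; Equivalence)
import Function.Construct.Composition as Composition
import Function.Construct.Identity as Identity
import Function.Construct.Symmetry as Symmetry
open import Level using (Level; _⊔_; suc; 0ℓ)
open import Relation.Binary.Bundles using (Setoid)
open import Relation.Binary.Core using (Rel)
open import Relation.Binary.Definitions using (_Respects_; _Respects₂_; Symmetric; Irreflexive)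
import Relation.Binary.Construct.On as On
import Relation.Binary.PropositionalEquality.Core as ≡
import Relation.Binary.PropositionalEquality.Properties as ≡
import Relation.Binary.Reasoning.Setoid as SetoidReasoning
open import Relation.Unary using (Pred; _∈_; _∉_)

private
  variable
    a b c d e ℓ ℓ′ p q s : Level

------------------------------------------------------------------------
-- Cardinality, isomorphism

HasCardinality : Setoid c ℓ → ℕ → Set (c ⊔ ℓ)
HasCardinality A n = Inverse A (≡.setoid (Fin n))

HasOrder : Group c ℓ → ℕ → Set (c ⊔ ℓ)
HasOrder G = HasCardinality (Group.setoid G)

IsAbelian : Group c ℓ → Set (c ⊔ ℓ)
IsAbelian G = Commutative _≈_ _∙_
  where open Group G

infix 4 _≅_

_≅_ : Group a ℓ → Group b ℓ′ → Set (a ⊔ b ⊔ ℓ ⊔ ℓ′)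
G ≅ K = ∃ IsGroupIsomorphism
  where open Morphism.GroupMorphisms (Group.rawGroup G) (Group.rawGroup K)

infixr 2 _×ᴳ_

_×ᴳ_ : Group a ℓ → Group b ℓ′ → Group (a ⊔ b) (ℓ ⊔ ℓ′)
_×ᴳ_ = DirectProduct.group

-- The parities under addition, i.e. ℤ/2ℤ.
C₂ : Group 0ℓ 0ℓ
C₂ = Parity.+-0-group

------------------------------------------------------------------------
-- Subgroups

record Subgroup (G : Group c ℓ) (p : Level) : Set (c ⊔ ℓ ⊔ suc p) where
  open Group G
  field
    members   : Pred Carrier p
    resp      : members Respects _≈_
    ε-closed  : ε ∈ members
    ∙-closed  : ∀ {x y} → x ∈ members → y ∈ members → x ∙ y ∈ members
    ⁻¹-closed : ∀ {x} → x ∈ members → x ⁻¹ ∈ members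

  group : Group (c ⊔ p) ℓ
  group = record
    { Carrier = Σ Carrier members
    ; _≈_     = _≈_ on proj₁
    ; _∙_     = λ (x , x∈) (y , y∈) → x ∙ y , ∙-closed x∈ y∈
    ; ε       = ε , ε-closed
    ; _⁻¹     = λ (x , x∈) → x ⁻¹ , ⁻¹-closed x∈
    ; isGroup = record
      { isMonoid = record
        { isSemigroup = record
          { isMagma = record
            { isEquivalence = On.isEquivalence proj₁ isEquivalence
            ; ∙-cong        = ∙-cong
            }
          ; assoc = λ (x , _) (y , _) (z , _) → assoc x y z
          }
        ; identity = (λ (x , _) → identityˡ x) , (λ (x , _) → identityʳ x)
        }
      ; inverse = (λ (x , _) → inverseˡ x) , (λ (x , _) → inverseʳ x)
      ; ⁻¹-cong = ⁻¹-cong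
      }
    }

  -- The quotient setoid of right cosets: Hx and Hy coincide iff xy⁻¹ ∈ H.
  rightCosets : Setoid c p
  rightCosets = record
    { Carrier       = Carrier
    ; _≈_           = λ x y → x ∙ y ⁻¹ ∈ members
    ; isEquivalence = record
      { refl  = λ {x} → resp (sym (inverseʳ x)) ε-closed
      ; sym   = λ {x} {y} xy⁻¹ → resp (swap x y) (⁻¹-closed xy⁻¹)
      ; trans = λ {x} {y} {z} xy⁻¹ yz⁻¹ → resp (cancel x y z) (∙-closed xy⁻¹ yz⁻¹)
      }
    }
    where
    open GroupProperties G using (⁻¹-anti-homo-∙; ⁻¹-involutive)
    open SetoidReasoning setoid

    swap : ∀ x y → (x ∙ y ⁻¹) ⁻¹ ≈ y ∙ x ⁻¹
    swap x y = begin
      (x ∙ y ⁻¹) ⁻¹     ≈⟨ ⁻¹-anti-homo-∙ x (y ⁻¹) ⟩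
      (y ⁻¹) ⁻¹ ∙ x ⁻¹  ≈⟨ ∙-congʳ (⁻¹-involutive y) ⟩
      y ∙ x ⁻¹          ∎

    cancel : ∀ x y z → (x ∙ y ⁻¹) ∙ (y ∙ z ⁻¹) ≈ x ∙ z ⁻¹
    cancel x y z = begin
      (x ∙ y ⁻¹) ∙ (y ∙ z ⁻¹)  ≈⟨ assoc x (y ⁻¹) (y ∙ z ⁻¹) ⟩
      x ∙ (y ⁻¹ ∙ (y ∙ z ⁻¹))  ≈⟨ ∙-congˡ (assoc (y ⁻¹) y (z ⁻¹)) ⟨
      x ∙ ((y ⁻¹ ∙ y) ∙ z ⁻¹)  ≈⟨ ∙-congˡ (∙-congʳ (inverseˡ y)) ⟩
      x ∙ (ε ∙ z ⁻¹)           ≈⟨ ∙-congˡ (identityˡ (z ⁻¹)) ⟩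
      x ∙ z ⁻¹                 ∎

  HasIndex : ℕ → Set (c ⊔ p)
  HasIndex = HasCardinality rightCosets

open Subgroup public using (members; HasIndex)

data Closure (G : Group c ℓ) (P : Pred (Group.Carrier G) p) :
             Pred (Group.Carrier G) (c ⊔ ℓ ⊔ p) where
  generator : ∀ {x} → x ∈ P → x ∈ Closure G P
  resp-≈    : ∀ {x y} → Group._≈_ G x y → x ∈ Closure G P → y ∈ Closure G P
  unit      : Group.ε G ∈ Closure G P
  product   : ∀ {x y} → x ∈ Closure G P → y ∈ Closure G P →
              Group._∙_ G x y ∈ Closure G P
  inverse   : ∀ {x} → x ∈ Closure G P → Group._⁻¹ G x ∈ Closure G P

-- The subgroup generated by P.
⟨_⟩ : {G : Group c ℓ} → Pred (Group.Carrier G) p → Subgroup G (c ⊔ ℓ ⊔ p)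
⟨_⟩ {G = G} P = record
  { members   = Closure G P
  ; resp      = resp-≈
  ; ε-closed  = unit
  ; ∙-closed  = product
  ; ⁻¹-closed = inverse
  }

------------------------------------------------------------------------
-- Permutation groups

-- Permutations are equal when they agree pointwise; (π ∙ ρ)(x) = π(ρ(x)).
Sym : Setoid c ℓ → Group (c ⊔ ℓ) (c ⊔ ℓ)
Sym V = record
  { Carrier = Inverse V V
  ; _≈_     = λ π ρ → ∀ x → to π x ≈ to ρ x
  ; _∙_     = λ π ρ → Composition.inverse ρ π
  ; ε       = Identity.inverse V
  ; _⁻¹     = Symmetry.inverse
  ; isGroup = record
    { isMonoid = record
      { isSemigroup = record
        { isMagma = record
          { isEquivalence = record
            { refl  = λ x → refl
            ; sym   = λ π≈ρ x → sym (π≈ρ x)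
            ; trans = λ π≈ρ ρ≈σ x → trans (π≈ρ x) (ρ≈σ x)
            }
          ; ∙-cong = λ {π} {_} {_} {σ} π≈ρ σ≈τ x →
                       trans (to-cong π (σ≈τ x)) (π≈ρ _)
          }
        ; assoc = λ _ _ _ _ → refl
        }
      ; identity = (λ _ _ → refl) , (λ _ _ → refl)
      }
    ; inverse = strictlyInverseʳ , strictlyInverseˡ
    ; ⁻¹-cong = λ {π} {ρ} π≈ρ x → inverseʳ π
                  (sym (trans (π≈ρ (from ρ x)) (strictlyInverseˡ ρ x)))
    }
  }
  where
  open Setoid V
  open Inverse

module _ {V : Setoid c ℓ} (P : Subgroup (Sym V) p) where
  open Setoid V
  open Inverse using (to)

  IsTransitive : Set (c ⊔ ℓ ⊔ p)
  IsTransitive = ∀ x y → ∃ λ π → π ∈ members P × to π x ≈ y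

  HasTrivialStabilisers : Set (c ⊔ ℓ ⊔ p)
  HasTrivialStabilisers =
    ∀ x {π} → π ∈ members P → to π x ≈ x → Group._≈_ (Sym V) π (Group.ε (Sym V))

  IsRegular : Set (c ⊔ ℓ ⊔ p)
  IsRegular = IsTransitive × HasTrivialStabilisers

------------------------------------------------------------------------
-- Graphs

record Graph (c ℓ e : Level) : Set (suc (c ⊔ ℓ ⊔ e)) where
  infix 4 _~_
  field
    vertices : Setoid c ℓ
  open Setoid vertices
  field
    _~_      : Rel Carrier e
    ~-resp   : _~_ Respects₂ _≈_
    ~-sym    : Symmetric _~_
    ~-irrefl : Irreflexive _≈_ _~_

open Graph using (vertices)

IsGraphIsomorphism : (X : Graph a ℓ e) (Y : Graph b ℓ′ d) →
                     Inverse (vertices X) (vertices Y) → Set (a ⊔ e ⊔ d)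
IsGraphIsomorphism X Y φ =
  ∀ x y → Graph._~_ X x y ⇔ Graph._~_ Y (Inverse.to φ x) (Inverse.to φ y)

infix 4 _≅ᵍ_

_≅ᵍ_ : Graph a ℓ e → Graph b ℓ′ d → Set (a ⊔ b ⊔ ℓ ⊔ ℓ′ ⊔ e ⊔ d)
X ≅ᵍ Y = ∃ (IsGraphIsomorphism X Y)

Aut : (X : Graph c ℓ e) → Subgroup (Sym (vertices X)) (c ⊔ e)
Aut X = record
  { members   = IsGraphIsomorphism X X
  ; resp      = λ π≈ρ π∈ x y → mk⇔
      (λ x~y → resp₂ (π≈ρ x) (π≈ρ y) (Equivalence.to (π∈ x y) x~y))
      (λ ρx~ρy → Equivalence.from (π∈ x y) (resp₂ (sym (π≈ρ x)) (sym (π≈ρ y)) ρx~ρy))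
  ; ε-closed  = λ x y → mk⇔ (λ x~y → x~y) (λ x~y → x~y)
  ; ∙-closed  = λ {_} {ρ} π∈ ρ∈ x y → mk⇔
      (Equivalence.to (π∈ (to ρ x) (to ρ y)) ∘ Equivalence.to (ρ∈ x y))
      (Equivalence.from (ρ∈ x y) ∘ Equivalence.from (π∈ (to ρ x) (to ρ y)))
  ; ⁻¹-closed = λ {π} π∈ x y → mk⇔
      (λ x~y → Equivalence.from (π∈ (from π x) (from π y))
        (resp₂ (sym (strictlyInverseˡ π x)) (sym (strictlyInverseˡ π y)) x~y))
      (λ x~y → resp₂ (strictlyInverseˡ π x) (strictlyInverseˡ π y)
        (Equivalence.to (π∈ (from π x) (from π y)) x~y))
  }
  where
  open Graph X
  open Setoid (vertices X)
  open Inverse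

  resp₂ : ∀ {x x′ y y′} → x ≈ x′ → y ≈ y′ → x ~ y → x′ ~ y′
  resp₂ x≈x′ y≈y′ x~y = proj₂ ~-resp x≈x′ (proj₁ ~-resp y≈y′ x~y)

------------------------------------------------------------------------
-- Cayley graphs

-- The inverse-closed subsets of G ∖ {1}.
record ConnectionSet (G : Group c ℓ) (s : Level) : Set (c ⊔ ℓ ⊔ suc s) where
  open Group G
  field
    elements  : Pred Carrier s
    resp      : elements Respects _≈_
    ε∉        : ε ∉ elements
    ⁻¹-closed : ∀ {x} → x ∈ elements → x ⁻¹ ∈ elements

open ConnectionSet public using (elements)

Cay : (G : Group c ℓ) → ConnectionSet G s → Graph c ℓ s
Cay G S = record
  { vertices = setoid
  ; _~_      = λ g h → h ∙ g ⁻¹ ∈ elements S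
  ; ~-resp   = (λ h≈h′ → resp (∙-congʳ h≈h′)) , (λ g≈g′ → resp (∙-congˡ (⁻¹-cong g≈g′)))
  ; ~-sym    = λ {g} {h} hg⁻¹ → resp
      (trans (⁻¹-anti-homo-∙ h (g ⁻¹)) (∙-congʳ (⁻¹-involutive g)))
      (⁻¹-closed hg⁻¹)
  ; ~-irrefl = λ {g} g≈h hg⁻¹ → ε∉
      (resp (trans (∙-congʳ (sym g≈h)) (inverseʳ g)) hg⁻¹)
  }
  where
  open Group G
  open ConnectionSet S using (resp; ε∉; ⁻¹-closed)
  open GroupProperties G using (⁻¹-anti-homo-∙; ⁻¹-involutive)

IsCayleyGraphOf : (s : Level) → Graph a ℓ e → Group b ℓ′ →
                  Set (a ⊔ b ⊔ ℓ ⊔ ℓ′ ⊔ e ⊔ suc s)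
IsCayleyGraphOf s X K = ∃ λ (S : ConnectionSet K s) → X ≅ᵍ Cay K S

module _ (G : Group c ℓ) where
  open Group G
  open GroupProperties G
    using (//-rightDividesˡ; //-rightDividesʳ; \\-leftDividesˡ; \\-leftDividesʳ)

  R : Carrier → Inverse setoid setoid
  R a = record
    { to        = λ x → x ∙ a
    ; from      = λ x → x ∙ a ⁻¹
    ; to-cong   = ∙-congʳ
    ; from-cong = ∙-congʳ
    ; inverse   = (λ {x} y≈ → trans (∙-congʳ y≈) (//-rightDividesˡ a x))
                , (λ {x} y≈ → trans (∙-congʳ y≈) (//-rightDividesʳ a x))
    }

  L : Carrier → Inverse setoid setoid
  L a = record
    { to        = λ x → a ∙ x
    ; from      = λ x → a ⁻¹ ∙ x
    ; to-cong   = ∙-congˡ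
    ; from-cong = ∙-congˡ
    ; inverse   = (λ {x} y≈ → trans (∙-congˡ y≈) (\\-leftDividesˡ a x))
                , (λ {x} y≈ → trans (∙-congˡ y≈) (\\-leftDividesʳ a x))
    }

  -- R(H) = { R h ∣ h ∈ H } and { L g }, as predicates up to equality of
  -- permutations.
  rightTranslations : Subgroup G p → Pred (Inverse setoid setoid) (c ⊔ ℓ ⊔ p)
  rightTranslations H π = ∃ λ h → h ∈ members H × Group._≈_ (Sym setoid) π (R h)

  leftTranslation : Carrier → Pred (Inverse setoid setoid) (c ⊔ ℓ)
  leftTranslation g π = Group._≈_ (Sym setoid) π (L g)

  -- gPg⁻¹ = { gsg⁻¹ ∣ s ∈ P }.
  conjugate : Carrier → Pred Carrier p → Pred Carrier (c ⊔ ℓ ⊔ p)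
  conjugate g P x = ∃ λ s → s ∈ P × x ≈ (g ∙ s) ∙ g ⁻¹

{-# OPTIONS --safe #-}
-- Every permutation in A has the form x ↦ xh or x ↦ gxh with h ∈ H.  The
-- generators commute, since left and right translations always do, so A is
-- abelian.  As H has index two, y ∈ H or g⁻¹y ∈ H, so A moves 1 to every y.  An
-- abelian transitive group is regular, and evaluation at 1 is then a bijection
-- A → G.  Since gSg⁻¹ = S, A acts by automorphisms, and a regular group of
-- automorphisms exhibits X as one of its Cayley graphs (Sabidussi).
module Submission where

open import Defs
open import Algebra.Bundles using (Group; AbelianGroup)
open import Algebra.Morphism.Consequences using (homomorphic₂-inv)
open import Algebra.Morphism.Definitions using (Homomorphic₂)
import Algebra.Properties.Group as GroupProperties
open import Data.Fin.Base using (Fin; zero; suc)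
open import Data.Fin.Properties using (_≟_)
open import Data.Nat.Base using (ℕ)
open import Data.Parity.Base using (0ℙ; 1ℙ)
open import Data.Product.Base using (Σ; ∃; _×_; _,_; proj₁; proj₂)
open import Data.Sum.Base using (inj₁; inj₂; [_,_])
open import Function.Base using (_∘_; _$_)
open import Function.Bundles using (Bijection; Equivalence; Injection; Inverse; mk⇔)
import Function.Construct.Composition as Composition
import Function.Construct.Symmetry as Symmetry
open import Function.Properties.Bijection using (Bijection⇒Inverse)
open import Function.Properties.Inverse using (Inverse⇒Bijection; Inverse⇒Injection)
open import Level using (Level; _⊔_)
open import Relation.Binary.Bundles using (Setoid)
open import Relation.Binary.PropositionalEquality.Core as ≡ using (_≡_; _≢_)
import Relation.Binary.Reasoning.Setoid as SetoidReasoning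
open import Relation.Nullary using (yes; no; contradiction)
open import Relation.Nullary.Decidable using (map′)
open import Relation.Unary using (Pred; Decidable; _∈_; _∉_; _⊆_; _≐_; _∪_)

private
  variable
    a b c ℓ ℓ′ e p q s : Level

-- Inversion, and isomorphisms from bijections

module _ (G : Group c ℓ) where
  open Group G
  open GroupProperties G using (⁻¹-selfInverse)

  inversion : Inverse setoid setoid
  inversion = record
    { to        = _⁻¹
    ; from      = _⁻¹
    ; to-cong   = ⁻¹-cong
    ; from-cong = ⁻¹-cong
    ; inverse   = (λ y≈x⁻¹ → ⁻¹-selfInverse (sym y≈x⁻¹))
                , (λ y≈x⁻¹ → ⁻¹-selfInverse (sym y≈x⁻¹))
    }

module _ (G : Group a ℓ) (K : Group b ℓ′) where
  private
    module G = Group G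
    module K = Group K
  open GroupProperties K using (identityˡ-unique; inverseˡ-unique)

  -- The image of `ε` is idempotent, hence `ε`; uniqueness of inverses then gives the rest.
  multiplicative⇒≅ : (φ : Inverse G.setoid K.setoid) →
                     Homomorphic₂ _ _ K._≈_ (Inverse.to φ) G._∙_ K._∙_ → G ≅ K
  multiplicative⇒≅ φ homo = to , record
    { isGroupMonomorphism = record
      { isGroupHomomorphism = record
        { isMonoidHomomorphism = record
          { isMagmaHomomorphism = record
            { isRelHomomorphism = record { cong = to-cong }
            ; homo              = homo
            }
          ; ε-homo = ε-homo
          }
        ; ⁻¹-homo = λ x → inverseˡ-unique _ _
            (K.trans (K.sym (homo _ x)) (K.trans (to-cong (G.inverseˡ x)) ε-homo))
        }
      ; injective = Bijection.injective (Inverse⇒Bijection φ)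
      }
    ; surjective = Bijection.surjective (Inverse⇒Bijection φ)
    }
    where
    open Inverse φ

    ε-homo : to G.ε K.≈ K.ε
    ε-homo = identityˡ-unique _ _
      (K.trans (K.sym (homo G.ε G.ε)) (to-cong (G.identityˡ G.ε)))

-- Generated subgroups

module _ {G : Group c ℓ} where
  open Group G

  -- Induction on `Closure`: a property that defines a subgroup need only be checked on generators.
  -- Below it is applied to centralisers and to `Aut`.
  ⟨⟩-least : {P : Pred Carrier q} (K : Subgroup G p) →
             P ⊆ members K → members (⟨_⟩ {G = G} P) ⊆ members K
  ⟨⟩-least K P⊆K (generator x∈)   = P⊆K x∈
  ⟨⟩-least K P⊆K (resp-≈ x≈y x∈)  = Subgroup.resp K x≈y (⟨⟩-least K P⊆K x∈)
  ⟨⟩-least K P⊆K unit             = Subgroup.ε-closed K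
  ⟨⟩-least K P⊆K (product x∈ y∈)  = Subgroup.∙-closed K (⟨⟩-least K P⊆K x∈) (⟨⟩-least K P⊆K y∈)
  ⟨⟩-least K P⊆K (inverse x∈)     = Subgroup.⁻¹-closed K (⟨⟩-least K P⊆K x∈)

  open GroupProperties G using (//-rightDividesʳ; \\-leftDividesʳ)
  open SetoidReasoning setoid

  centraliser : Pred Carrier q → Subgroup G (c ⊔ ℓ ⊔ q)
  centraliser P = record
    { members   = λ x → ∀ {z} → z ∈ P → x ∙ z ≈ z ∙ x
    ; resp      = λ x≈y xz z∈ → trans (∙-congʳ (sym x≈y)) (trans (xz z∈) (∙-congˡ x≈y))
    ; ε-closed  = λ _ → trans (identityˡ _) (sym (identityʳ _))
    ; ∙-closed  = λ {x} {y} xz yz {z} z∈ → begin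
        (x ∙ y) ∙ z  ≈⟨ assoc x y z ⟩
        x ∙ (y ∙ z)  ≈⟨ ∙-congˡ (yz z∈) ⟩
        x ∙ (z ∙ y)  ≈⟨ assoc x z y ⟨
        (x ∙ z) ∙ y  ≈⟨ ∙-congʳ (xz z∈) ⟩
        (z ∙ x) ∙ y  ≈⟨ assoc z x y ⟩
        z ∙ (x ∙ y)  ∎
    ; ⁻¹-closed = λ {x} xz {z} z∈ → begin
        x ⁻¹ ∙ z                ≈⟨ ∙-congˡ (//-rightDividesʳ x z) ⟨
        x ⁻¹ ∙ ((z ∙ x) ∙ x ⁻¹) ≈⟨ ∙-congˡ (∙-congʳ (xz z∈)) ⟨
        x ⁻¹ ∙ ((x ∙ z) ∙ x ⁻¹) ≈⟨ ∙-congˡ (assoc x z (x ⁻¹)) ⟩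
        x ⁻¹ ∙ (x ∙ (z ∙ x ⁻¹)) ≈⟨ \\-leftDividesʳ x (z ∙ x ⁻¹) ⟩
        z ∙ x ⁻¹                ∎
    }

  -- The inner induction puts the whole of `⟨ P ⟩` in the centraliser of `P`. Read symmetrically,
  -- this puts `P` in the centraliser of `⟨ P ⟩`, and the outer induction extends that to `⟨ P ⟩`.
  commuting⇒⟨⟩-abelian : (P : Pred Carrier q) →
                         (∀ {x y} → x ∈ P → y ∈ P → x ∙ y ≈ y ∙ x) →
                         IsAbelian (Subgroup.group (⟨_⟩ {G = G} P))
  commuting⇒⟨⟩-abelian P comm (_ , x∈) (_ , y∈) =
    ⟨⟩-least (centraliser (members (⟨_⟩ {G = G} P)))
      (λ x∈P y∈⟨P⟩ → sym (⟨⟩-least (centraliser P) (λ x∈ y∈ → comm x∈ y∈) y∈⟨P⟩ x∈P))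
      x∈ y∈

-- Regular permutation groups

module _ {V : Setoid c ℓ} (P : Subgroup (Sym V) p) where
  open Setoid V
  open Inverse using (to; to-cong; strictlyInverseˡ; strictlyInverseʳ)
  private
    module P = Subgroup P
    module Sym = Group (Sym V)

  -- Any `x` is brought to any `y` by way of `v`.
  orbit-transitive : ∀ v → (∀ y → ∃ λ π → π ∈ members P × to π v ≈ y) → IsTransitive P
  orbit-transitive v reach x y with reach x | reach y
  ... | π , π∈ , πv≈x | ρ , ρ∈ , ρv≈y =
    ρ Sym.∙ π Sym.⁻¹ , P.∙-closed ρ∈ (P.⁻¹-closed π∈) ,
    trans (to-cong ρ (Inverse.inverseʳ π (sym πv≈x))) ρv≈y

  -- If `π` fixes `x`, it fixes every `ρ x`, because it commutes with `ρ`; by transitivity these are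
  -- all the points.
  abelian∧transitive⇒regular : IsAbelian (Subgroup.group P) → IsTransitive P → IsRegular P
  abelian∧transitive⇒regular comm transitive = transitive , trivialStabilisers
    where
    open SetoidReasoning V

    trivialStabilisers : HasTrivialStabilisers P
    trivialStabilisers x {π} π∈ πx≈x y with transitive x y
    ... | ρ , ρ∈ , ρx≈y = begin
      to π y          ≈⟨ to-cong π ρx≈y ⟨
      to π (to ρ x)   ≈⟨ comm (π , π∈) (ρ , ρ∈) x ⟩
      to ρ (to π x)   ≈⟨ to-cong ρ πx≈x ⟩
      to ρ x          ≈⟨ ρx≈y ⟩
      y               ∎

  module _ (regular : IsRegular P) (v : Carrier) where

    -- The permutation `π ∙ ρ ⁻¹` fixes the point `ρ v`, so it is trivial.
    evaluation-injective : ∀ {π ρ} → π ∈ members P → ρ ∈ members P →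
                           to π v ≈ to ρ v → π Sym.≈ ρ
    evaluation-injective {π} {ρ} π∈ ρ∈ πv≈ρv = x∙y⁻¹≈ε⇒x≈y π ρ $
      proj₂ regular (to ρ v) (P.∙-closed π∈ (P.⁻¹-closed ρ∈))
        (trans (to-cong π (strictlyInverseʳ ρ v)) πv≈ρv)
      where open GroupProperties (Sym V) using (x∙y⁻¹≈ε⇒x≈y)

    evaluation : Inverse (Group.setoid P.group) V
    evaluation = Bijection⇒Inverse record
      { to        = λ (π , _) → to π v
      ; cong      = λ π≈ρ → π≈ρ v
      ; bijective = (λ {(_ , π∈)} {(_ , ρ∈)} → evaluation-injective π∈ ρ∈)
                  , (λ y → let (π , π∈ , πv≈y) = proj₁ regular v y
                           in (π , π∈) , λ ρ≈π → trans (ρ≈π v) πv≈y)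
      }

-- Sabidussi's theorem

module _ (X : Graph c ℓ e) (P : Subgroup (Sym (Graph.vertices X)) p) where
  open Graph X
  open Setoid vertices
  open Inverse using (to; strictlyInverseˡ; strictlyInverseʳ)
  private module P = Subgroup P

  -- A vertex x = πv is sent to π⁻¹ rather than to π, because Cay
  -- joins π and ρ when ρπ⁻¹, not π⁻¹ρ, lies in the connection set.
  sabidussi : members P ⊆ members (Aut X) → IsRegular P → Carrier →
              IsCayleyGraphOf e X P.group
  sabidussi P⊆Aut regular v = neighbours , φ , φ-isGraphIsomorphism
    where
    ~-respʳ : ∀ {x y z} → y ≈ z → x ~ y → x ~ z
    ~-respʳ = proj₁ ~-resp

    ~-respˡ : ∀ {x y z} → x ≈ y → x ~ z → y ~ z
    ~-respˡ = proj₂ ~-resp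

    neighbours : ConnectionSet P.group _
    neighbours = record
      { elements  = λ (π , _) → v ~ to π v
      ; resp      = λ π≈ρ → ~-respʳ (π≈ρ v)
      ; ε∉        = ~-irrefl refl
      -- Applying the automorphism `π ⁻¹` to the edge from `v` to `π v` gives an edge from `π ⁻¹ v`
      -- to `v`.
      ; ⁻¹-closed = λ {(π , π∈)} v~πv → ~-sym $
          ~-respʳ (strictlyInverseʳ π v)
            (Equivalence.to (P⊆Aut (P.⁻¹-closed π∈) v (to π v)) v~πv)
      }

    φ : Inverse vertices (Group.setoid P.group)
    φ = Composition.inverse (Symmetry.inverse (evaluation P regular v)) (inversion P.group)

    φ-isGraphIsomorphism : IsGraphIsomorphism X (Cay P.group neighbours) φ
    -- Adjacency of `φ x` and `φ y` unfolds to `v ~ ρ (at x v)`. This is `ρ y ~ ρ x`, which is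
    -- equivalent to `y ~ x` since `ρ` is an automorphism.
    φ-isGraphIsomorphism x y = mk⇔
      (λ x~y → ~-respˡ ρy≈v (~-respʳ ρx≈ (Equivalence.to ρ-edge (~-sym x~y))))
      (λ v~ → ~-sym (Equivalence.from ρ-edge (~-respˡ (sym ρy≈v) (~-respʳ (sym ρx≈) v~))))
      where
      at : Carrier → Group.Carrier P.group
      at = Inverse.from (evaluation P regular v)

      at-v : ∀ z → to (proj₁ (at z)) v ≈ z
      at-v = strictlyInverseˡ (evaluation P regular v)

      ρ : Group.Carrier P.group
      ρ = Group._⁻¹ P.group (at y)

      ρ-edge = P⊆Aut (proj₂ ρ) y x

      ρy≈v : to (proj₁ ρ) y ≈ v
      ρy≈v = Inverse.inverseʳ (proj₁ (at y)) (sym (at-v y))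

      ρx≈ : to (proj₁ ρ) x ≈ to (proj₁ ρ) (to (proj₁ (at x)) v)
      ρx≈ = Inverse.to-cong (proj₁ ρ) (sym (at-v x))

-- Subgroups of index two

Fin2-pigeonhole : {i j k : Fin 2} → i ≢ k → j ≢ k → i ≡ j
Fin2-pigeonhole {zero}     {zero}     i≢k j≢k = ≡.refl
Fin2-pigeonhole {suc zero} {suc zero} i≢k j≢k = ≡.refl
Fin2-pigeonhole {zero}     {suc zero} {zero}     i≢k j≢k = contradiction ≡.refl i≢k
Fin2-pigeonhole {zero}     {suc zero} {suc zero} i≢k j≢k = contradiction ≡.refl j≢k
Fin2-pigeonhole {suc zero} {zero}     {zero}     i≢k j≢k = contradiction ≡.refl j≢k
Fin2-pigeonhole {suc zero} {zero}     {suc zero} i≢k j≢k = contradiction ≡.refl i≢k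

module _ (G : Group c ℓ) (H : Subgroup G p) where
  open Group G
  open GroupProperties G using (ε⁻¹≈ε; ⁻¹-involutive; x≈z//y)
  private module H = Subgroup H

  ∉-⁻¹ : ∀ {x} → x ∉ members H → x ⁻¹ ∉ members H
  ∉-⁻¹ x∉ x⁻¹∈ = x∉ (H.resp (⁻¹-involutive _) (H.⁻¹-closed x⁻¹∈))

  ∉-∙-∈ : ∀ {x h} → x ∉ members H → h ∈ members H → x ∙ h ∉ members H
  ∉-∙-∈ x∉ h∈ xh∈ =
    x∉ (H.resp (sym (x≈z//y _ _ _ refl)) (H.∙-closed xh∈ (H.⁻¹-closed h∈)))

  module _ (index : HasIndex H 2) where
    open Inverse index using (to; to-cong)

    private
      to-injective : ∀ {x y} → to x ≡ to y → x ∙ y ⁻¹ ∈ members H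
      to-injective = Injection.injective (Inverse⇒Injection index)

      xε⁻¹≈x : ∀ x → x ∙ ε ⁻¹ ≈ x
      xε⁻¹≈x x = trans (∙-congˡ ε⁻¹≈ε) (identityʳ x)

      to-ε⇒∈ : ∀ {x} → to x ≡ to ε → x ∈ members H
      to-ε⇒∈ eq = H.resp (xε⁻¹≈x _) (to-injective eq)

    -- The index bijection labels cosets by `Fin 2`, where equality is decidable, and `H` is the
    -- coset labelled like `ε`.
    ∈-dec : Decidable (members H)
    ∈-dec x = map′ to-ε⇒∈ (λ x∈ → to-cong (H.resp (sym (xε⁻¹≈x x)) x∈)) (to x ≟ to ε)

    -- Both `x` and `y ⁻¹` avoid the coset of `ε`, so they share the only other one; hence
    -- `x ∙ (y ⁻¹) ⁻¹` lies in `H`.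
    ∉-∙-∉ : ∀ {x y} → x ∉ members H → y ∉ members H → x ∙ y ∈ members H
    ∉-∙-∉ x∉ y∉ = H.resp (∙-congˡ (⁻¹-involutive _)) $
      to-injective (Fin2-pigeonhole (x∉ ∘ to-ε⇒∈) (∉-⁻¹ y∉ ∘ to-ε⇒∈))

-- Translations of Cayley graphs

module _ {G : Group c ℓ} (S : ConnectionSet G s) where
  open Group G
  open ConnectionSet S using (resp)
  open GroupProperties G using (⁻¹-anti-homo-∙; //-rightDividesʳ; ∙-cancelˡ; ∙-cancelʳ)
  open SetoidReasoning setoid

  R∈Aut : ∀ a → R G a ∈ members (Aut (Cay G S))
  R∈Aut a x y = mk⇔ (resp (sym quotient)) (resp quotient)
    where
    quotient : (y ∙ a) ∙ (x ∙ a) ⁻¹ ≈ y ∙ x ⁻¹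
    quotient = begin
      (y ∙ a) ∙ (x ∙ a) ⁻¹       ≈⟨ ∙-congˡ (⁻¹-anti-homo-∙ x a) ⟩
      (y ∙ a) ∙ (a ⁻¹ ∙ x ⁻¹)    ≈⟨ assoc _ _ _ ⟨
      ((y ∙ a) ∙ a ⁻¹) ∙ x ⁻¹    ≈⟨ ∙-congʳ (//-rightDividesʳ a y) ⟩
      y ∙ x ⁻¹                   ∎

  -- Left translation by `g` conjugates the quotient `y ∙ x ⁻¹` by `g`. One inclusion preserves
  -- edges; the other, with cancellation of `g`, reflects them.
  L∈Aut : ∀ {g} → conjugate G g (elements S) ≐ elements S → L G g ∈ members (Aut (Cay G S))
  L∈Aut {g} (gSg⁻¹⊆S , S⊆gSg⁻¹) x y = mk⇔
    (λ yx⁻¹∈ → gSg⁻¹⊆S (y ∙ x ⁻¹ , yx⁻¹∈ , quotient))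
    (λ q∈ → let (t , t∈ , q≈gtg⁻¹) = S⊆gSg⁻¹ q∈ in
      resp (∙-cancelˡ g _ _ (∙-cancelʳ (g ⁻¹) _ _ (trans (sym q≈gtg⁻¹) quotient))) t∈)
    where
    quotient : (g ∙ y) ∙ (g ∙ x) ⁻¹ ≈ (g ∙ (y ∙ x ⁻¹)) ∙ g ⁻¹
    quotient = begin
      (g ∙ y) ∙ (g ∙ x) ⁻¹       ≈⟨ ∙-congˡ (⁻¹-anti-homo-∙ g x) ⟩
      (g ∙ y) ∙ (x ⁻¹ ∙ g ⁻¹)    ≈⟨ assoc _ _ _ ⟨
      ((g ∙ y) ∙ x ⁻¹) ∙ g ⁻¹    ≈⟨ ∙-congʳ (assoc _ _ _) ⟩
      (g ∙ (y ∙ x ⁻¹)) ∙ g ⁻¹    ∎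

-- The group generated by R(H) and L_g

module _ (G : Group c ℓ) (H : Subgroup G p) (g : Group.Carrier G) where
  open Group G
  open Inverse using (to)
  open SetoidReasoning setoid
  private
    module H = Subgroup H
    module Sym = Group (Sym setoid)

  translationGroup : Subgroup (Sym setoid) (c ⊔ ℓ ⊔ p)
  translationGroup = ⟨ rightTranslations G H ∪ leftTranslation G g ⟩

  private module A = Subgroup translationGroup

  translationGroup-abelian : IsAbelian H.group → IsAbelian A.group
  translationGroup-abelian abelian = commuting⇒⟨⟩-abelian _ λ {π} {ρ} → commute {π} {ρ}
    where
    -- Generators are translations only up to pointwise equality, so commutation is transported from
    -- the translations themselves.
    translate : ∀ {π π′ ρ ρ′} → π Sym.≈ π′ → ρ Sym.≈ ρ′ →
                π′ Sym.∙ ρ′ Sym.≈ ρ′ Sym.∙ π′ → π Sym.∙ ρ Sym.≈ ρ Sym.∙ π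
    translate {π} {π′} {ρ} {ρ′} π≈π′ ρ≈ρ′ comm = Sym.trans {π Sym.∙ ρ} {π′ Sym.∙ ρ′} {ρ Sym.∙ π}
      (Sym.∙-cong {π} {π′} {ρ} {ρ′} π≈π′ ρ≈ρ′)
      (Sym.trans {π′ Sym.∙ ρ′} {ρ′ Sym.∙ π′} {ρ Sym.∙ π} comm
        (Sym.sym {ρ Sym.∙ π} {ρ′ Sym.∙ π′} (Sym.∙-cong {ρ} {ρ′} {π} {π′} ρ≈ρ′ π≈π′)))

    commute : ∀ {π ρ} → π ∈ (rightTranslations G H ∪ leftTranslation G g) →
              ρ ∈ (rightTranslations G H ∪ leftTranslation G g) →
              π Sym.∙ ρ Sym.≈ ρ Sym.∙ π
    commute {π} {ρ} (inj₁ (h , h∈ , π≈)) (inj₁ (k , k∈ , ρ≈)) =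
      translate {π} {R G h} {ρ} {R G k} π≈ ρ≈ λ x → begin
        (x ∙ k) ∙ h  ≈⟨ assoc x k h ⟩
        x ∙ (k ∙ h)  ≈⟨ ∙-congˡ (abelian (k , k∈) (h , h∈)) ⟩
        x ∙ (h ∙ k)  ≈⟨ assoc x h k ⟨
        (x ∙ h) ∙ k  ∎
    commute {π} {ρ} (inj₁ (h , _ , π≈)) (inj₂ ρ≈) =
      translate {π} {R G h} {ρ} {L G g} π≈ ρ≈ λ x → assoc g x h
    commute {π} {ρ} (inj₂ π≈) (inj₁ (k , _ , ρ≈)) =
      translate {π} {L G g} {ρ} {R G k} π≈ ρ≈ λ x → sym (assoc g x k)
    commute {π} {ρ} (inj₂ π≈) (inj₂ ρ≈) =
      translate {π} {L G g} {ρ} {L G g} π≈ ρ≈ λ x → refl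

  translationGroup⊆Aut : (S : ConnectionSet G s) → conjugate G g (elements S) ≐ elements S →
                         A.members ⊆ members (Aut (Cay G S))
  translationGroup⊆Aut S gSg⁻¹≐S = ⟨⟩-least (Aut (Cay G S)) λ {π} →
    [ (λ (h , _ , π≈) → Aut.resp {R G h} {π} (Sym.sym {π} {R G h} π≈) (R∈Aut S h))
    , (λ π≈ → Aut.resp {L G g} {π} (Sym.sym {π} {L G g} π≈) (L∈Aut S gSg⁻¹≐S)) ]
    where module Aut = Subgroup (Aut (Cay G S))

  -- The normal forms of elements of `A`: the parity records whether the factor `L g` occurs.
  translation : Group.Carrier (H.group ×ᴳ C₂) → Group.Carrier A.group
  translation ((h , h∈) , 0ℙ) = R G h , generator (inj₁ (h , h∈ , λ _ → refl))
  translation ((h , h∈) , 1ℙ) =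
    L G g Sym.∙ R G h ,
    product {x = L G g} {y = R G h}
      (generator (inj₂ λ _ → refl)) (generator (inj₁ (h , h∈ , λ _ → refl)))

  translation-∙ : IsAbelian H.group → g ∙ g ≈ ε →
                  Homomorphic₂ _ _ (Group._≈_ A.group) translation
                    (Group._∙_ (H.group ×ᴳ C₂)) (Group._∙_ A.group)
  translation-∙ abelian g²≈ε ((h , h∈) , i) ((k , k∈) , j) = homo i j
    where
    -- Composition applies `R k` first, so `R` reverses products; commutativity of `H` restores the
    -- order.
    R-homo : ∀ x → x ∙ (h ∙ k) ≈ (x ∙ k) ∙ h
    R-homo x = trans (∙-congˡ (abelian (h , h∈) (k , k∈))) (sym (assoc x k h))

    homo : ∀ i j → let open Group A.group renaming (_∙_ to _∘ᴬ_; _≈_ to _≈ᴬ_) in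
           translation (Group._∙_ (H.group ×ᴳ C₂) ((h , h∈) , i) ((k , k∈) , j)) ≈ᴬ
           (translation ((h , h∈) , i) ∘ᴬ translation ((k , k∈) , j))
    homo 0ℙ 0ℙ x = R-homo x
    homo 0ℙ 1ℙ x = trans (∙-congˡ (R-homo x)) (sym (assoc _ _ _))
    homo 1ℙ 0ℙ x = ∙-congˡ (R-homo x)
    -- The parities add up to `0ℙ`, so the two factors `g` on the right must cancel.
    homo 1ℙ 1ℙ x = begin
      x ∙ (h ∙ k)              ≈⟨ R-homo x ⟩
      (x ∙ k) ∙ h              ≈⟨ identityˡ _ ⟨
      ε ∙ ((x ∙ k) ∙ h)        ≈⟨ ∙-congʳ g²≈ε ⟨
      (g ∙ g) ∙ ((x ∙ k) ∙ h)  ≈⟨ assoc _ _ _ ⟩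
      g ∙ (g ∙ ((x ∙ k) ∙ h))  ≈⟨ ∙-congˡ (assoc _ _ _) ⟨
      g ∙ ((g ∙ (x ∙ k)) ∙ h)  ∎

  open GroupProperties G using (\\-leftDividesˡ; ∙-cancelˡ)

  translation-reaches : HasIndex H 2 → g ∉ members H →
                        ∀ y → ∃ λ hi → to (proj₁ (translation hi)) ε ≈ y
  translation-reaches index g∉ y with ∈-dec G H index y
  ... | yes y∈ = ((y , y∈) , 0ℙ) , identityˡ y
  -- Neither `g ⁻¹` nor `y` is in `H`, so index two puts their product there.
  ... | no  y∉ = ((g ⁻¹ ∙ y , ∉-∙-∉ G H index (∉-⁻¹ G H g∉) y∉) , 1ℙ) ,
                 trans (∙-congˡ (identityˡ _)) (\\-leftDividesˡ g y)

  -- At `ε` the value lies in `H` for parity `0ℙ` and outside `H` for `1ℙ`, so the parities agree;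
  -- cancellation then recovers the element of `H`.
  translation-injective : g ∉ members H →
                          ∀ {hi kj} → Group._≈_ A.group (translation hi) (translation kj) →
                          Group._≈_ (H.group ×ᴳ C₂) hi kj
  translation-injective g∉ {(h , _)  , 0ℙ} {(k , _)  , 0ℙ} eq =
    ∙-cancelˡ ε h k (eq ε) , ≡.refl
  translation-injective g∉ {(h , h∈) , 0ℙ} {(k , k∈) , 1ℙ} eq =
    contradiction (H.resp (eq ε) (H.∙-closed H.ε-closed h∈))
      (∉-∙-∈ G H g∉ (H.∙-closed H.ε-closed k∈))
  translation-injective g∉ {(h , h∈) , 1ℙ} {(k , k∈) , 0ℙ} eq =
    contradiction (H.resp (sym (eq ε)) (H.∙-closed H.ε-closed k∈))
      (∉-∙-∈ G H g∉ (H.∙-closed H.ε-closed h∈))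
  translation-injective g∉ {(h , _)  , 1ℙ} {(k , _)  , 1ℙ} eq =
    ∙-cancelˡ ε h k (∙-cancelˡ g _ _ (eq ε)) , ≡.refl

  module _ (abelian : IsAbelian H.group) (index : HasIndex H 2) (g∉ : g ∉ members H) where

    translationGroup-regular : IsRegular translationGroup
    translationGroup-regular =
      abelian∧transitive⇒regular translationGroup (translationGroup-abelian abelian) $
        orbit-transitive translationGroup ε λ y →
          let (hi , ε↦y) = translation-reaches index g∉ y
              (π , π∈)   = translation hi
          in π , π∈ , ε↦y

    translation-inverse : Inverse (Group.setoid (H.group ×ᴳ C₂)) (Group.setoid A.group)
    translation-inverse = Bijection⇒Inverse record
      { to        = translation
      ; cong      = λ {hi} {kj} → translation-cong {hi} {kj}
      ; bijective = (λ {hi} {kj} → translation-injective g∉ {hi} {kj})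
                  -- A normal form agreeing with `π` at `ε` equals `π` by regularity, so no
                  -- induction on words in the generators is required.
                  , λ (π , π∈) → let (hi , ε↦πε) = translation-reaches index g∉ (to π ε) in
                      hi , λ {kj} kj≈hi →
                        evaluation-injective translationGroup translationGroup-regular ε
                          (proj₂ (translation kj)) π∈
                          (trans (translation-cong {kj} {hi} kj≈hi ε) ε↦πε)
      }
      where
      translation-cong : ∀ {hi kj} → Group._≈_ (H.group ×ᴳ C₂) hi kj →
                         Group._≈_ A.group (translation hi) (translation kj)
      translation-cong {_ , 0ℙ} (h≈k , ≡.refl) x = ∙-congˡ h≈k
      translation-cong {_ , 1ℙ} (h≈k , ≡.refl) x = ∙-congˡ (∙-congˡ h≈k)

    translationGroup≅H×C₂ : g ∙ g ≈ ε → A.group ≅ (H.group ×ᴳ C₂)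
    translationGroup≅H×C₂ g²≈ε =
      -- Multiplicativity is known for `translation`, which points the other way, and passes to its
      -- inverse.
      multiplicative⇒≅ A.group (H.group ×ᴳ C₂) (Symmetry.inverse translation-inverse)
        (homomorphic₂-inv (Group.magma (H.group ×ᴳ C₂)) (Group.magma A.group)
          {translation} {from} (λ {π} {ρ} → from-cong {π} {ρ})
          (Inverse.inverse translation-inverse) (translation-∙ abelian g²≈ε))
      where open Inverse translation-inverse using (from; from-cong)

lemma5p1 : {c ℓ p s : Level} (G : Group c ℓ) (n : ℕ) → HasOrder G n →
           (H : Subgroup G p) → IsAbelian (Subgroup.group H) → HasIndex H 2 →
           (S : ConnectionSet G s) (g : Group.Carrier G) → g ∉ members H →
           conjugate G g (elements S) ≐ elements S →
           let open Group G
               X = Cay G S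
               A : Subgroup (Sym setoid) (c ⊔ ℓ ⊔ p)
               A = ⟨ rightTranslations G H ∪ leftTranslation G g ⟩
           in (members A ⊆ members (Aut X)
               × IsAbelian (Subgroup.group A)
               × IsRegular A
               × HasOrder (Subgroup.group A) n)
              × Σ (AbelianGroup (c ⊔ ℓ ⊔ p) (c ⊔ ℓ))
                  (λ K → IsCayleyGraphOf s X (AbelianGroup.group K))
              × (g ∙ g ≈ ε → Subgroup.group A ≅ (Subgroup.group H ×ᴳ C₂))
lemma5p1 G n order H abelian index S g g∉ gSg⁻¹≐S =
    ( A⊆Aut
    , A-abelian
    , A-regular
    , Composition.inverse (evaluation A A-regular ε) order
    )
  -- The abelian group is `A` itself; `ε` serves as base vertex.
  , ( record
        { isAbelianGroup = record
          { isGroup = Group.isGroup (Subgroup.group A)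
          ; comm    = A-abelian
          }
        }
    , sabidussi (Cay G S) A A⊆Aut A-regular ε
    )
  , translationGroup≅H×C₂ G H g abelian index g∉
  where
  open Group G using (ε)
  A         = translationGroup G H g
  A⊆Aut     = translationGroup⊆Aut G H g S gSg⁻¹≐S
  A-abelian = translationGroup-abelian G H g abelian
  A-regular = translationGroup-regular G H g abelian index g∉
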